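{- Let $F\colon\mathbb{F}_2^n\to\mathbb{F}_2^2$ be a bent function. Then there are only two possible preimage distributions for $F$, namely: type $(+)$: for some $\alpha\in\mathbb{F}_2^2$, $|F^{ -1}(\alpha)|=2^{n-2}+2^{n/2}-2^{n/2-2}$ and $|F^{ -1}(\beta)|=2^{n-2}-2^{n/2-2}$ for all $\beta\neq\alpha$; type $(-)$: for some $\alpha\in\mathbb{F}_2^2$, $|F^{ -1}(\alpha)|=2^{n-2}-2^{n/2}+2^{n/2-2}$ and $|F^{ -1}(\beta)|=2^{n-2}+2^{n/2-2}$ for all $\beta\neq\alpha$. Both distributions occur (for some bent function $\mathbb{F}_2^n\to\mathbb{F}_2^2$) for any even $n\ge4$.
   Context: A function $F\colon\mathbb{F}_2^n\to\mathbb{F}_2^m$ is bent (perfect nonlinear) if $|\{x: F(x+a)-F(x)=b\}|=2^{n-m}$ for all nonzero $a\in\mathbb{F}_2^n$ and all $b\in\mathbb{F}_2^m$. The preimage distribution (value distribution) of $F$ is the multiset of the sizes $|F^{ -1}(\beta)|$, $\beta\in\mathbb{F}_2^m$. -}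

module Defs where

open import Data.Bool.Base using (Bool; true; false; _xor_)
import Data.Bool.Properties as Bool
open import Data.Integer.Base as ℤ using (ℤ; +_; -[1+_])
open import Data.List.Base using (List; []; _∷_; _++_; map; filter; length)
open import Data.Nat.Base as ℕ using (ℕ; zero; suc)
open import Data.Nat.Divisibility using (_∣_; quotient)
open import Data.Nat.Properties using (m^n≢0)
open import Data.Product.Base using (Σ-syntax; _×_)
open import Data.Rational.Base as ℚ using (ℚ)
open import Data.Vec.Base using (Vec; []; _∷_; zipWith; replicate)
open import Data.Vec.Properties using (≡-dec)
open import Level using (0ℓ)
open import Relation.Binary.Definitions using (DecidableEquality)
open import Relation.Binary.PropositionalEquality using (_≡_; _≢_)
open import Relation.Unary using (Pred; Decidable)

-- The two-element field is Bool with _xor_ as addition and _∧_ as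
-- multiplication (Data.Bool.Properties.xor-∧-commutativeRing).
𝔽₂^_ : ℕ → Set
𝔽₂^ n = Vec Bool n

infixl 6 _⊕_ _⊖_

_⊕_ : ∀ {n} → 𝔽₂^ n → 𝔽₂^ n → 𝔽₂^ n
_⊕_ = zipWith _xor_

-- In characteristic 2 every element is its own negative.
_⊖_ : ∀ {n} → 𝔽₂^ n → 𝔽₂^ n → 𝔽₂^ n
x ⊖ y = x ⊕ y

𝟎 : ∀ {n} → 𝔽₂^ n
𝟎 = replicate _ false

_≟_ : ∀ {n} → DecidableEquality (𝔽₂^ n)
_≟_ = ≡-dec Bool._≟_

-- Every vector occurs exactly once in this list.
vectors : ∀ n → List (𝔽₂^ n)
vectors zero    = [] ∷ []
vectors (suc n) = map (false ∷_) (vectors n) ++ map (true ∷_) (vectors n)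

∣_∣ : ∀ {n} {P : Pred (𝔽₂^ n) 0ℓ} → Decidable P → ℕ
∣_∣ {n} P? = length (filter P? (vectors n))

fromℕ : ℕ → ℚ
fromℕ k = + k ℚ./ 1

-- Integer powers of 2. Exponents such as n - m or n/2 - 2 may be negative,
-- so sizes are compared in ℚ rather than with truncated subtraction in ℕ.
2^_ : ℤ → ℚ
2^ (+ k)      = fromℕ (2 ℕ.^ k)
2^ (-[1+ k ]) = (+ 1 ℚ./ (2 ℕ.^ suc k)) {{m^n≢0 2 (suc k)}}

Bent : ∀ {n m} → (𝔽₂^ n → 𝔽₂^ m) → Set
Bent {n} {m} F =
  ∀ (a : 𝔽₂^ n) → a ≢ 𝟎 → ∀ (b : 𝔽₂^ m) →
  fromℕ ∣ (λ x → (F (x ⊕ a) ⊖ F x) ≟ b) ∣ ≡ 2^ (+ n ℤ.- + m)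

∣_⁻¹⟨_⟩∣ : ∀ {n m} → (𝔽₂^ n → 𝔽₂^ m) → 𝔽₂^ m → ℕ
∣ F ⁻¹⟨ β ⟩∣ = ∣ (λ x → F x ≟ β) ∣

-- The sizes involve 2^(n/2) with n/2 an integer: a type includes the
-- evenness of n, and n/2 is the quotient of the divisibility 2 ∣ n.
Type⁺ : ∀ {n} → (𝔽₂^ n → 𝔽₂^ 2) → Set
Type⁺ {n} F =
  Σ[ even ∈ 2 ∣ n ]
  let n/2 = + quotient even in
  Σ[ α ∈ 𝔽₂^ 2 ]
    (fromℕ ∣ F ⁻¹⟨ α ⟩∣ ≡ 2^ (+ n ℤ.- + 2) ℚ.+ 2^ n/2 ℚ.- 2^ (n/2 ℤ.- + 2))
  × (∀ β → β ≢ α →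
     fromℕ ∣ F ⁻¹⟨ β ⟩∣ ≡ 2^ (+ n ℤ.- + 2) ℚ.- 2^ (n/2 ℤ.- + 2))

Type⁻ : ∀ {n} → (𝔽₂^ n → 𝔽₂^ 2) → Set
Type⁻ {n} F =
  Σ[ even ∈ 2 ∣ n ]
  let n/2 = + quotient even in
  Σ[ α ∈ 𝔽₂^ 2 ]
    (fromℕ ∣ F ⁻¹⟨ α ⟩∣ ≡ 2^ (+ n ℤ.- + 2) ℚ.- 2^ n/2 ℚ.+ 2^ (n/2 ℤ.- + 2))
  × (∀ β → β ≢ α →
     fromℕ ∣ F ⁻¹⟨ β ⟩∣ ≡ 2^ (+ n ℤ.- + 2) ℚ.+ 2^ (n/2 ℤ.- + 2))

{-# OPTIONS --safe #-}
-- For a bent F and a nonzero character χ of 𝔽₂², the square of the Walsh sum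
-- W_χ = Σ_x χ(F x) is the sum over a of Σ_x χ(F(x + a) - F x), in which only
-- a = 0 contributes, so W_χ² = 2^n.  Hence n is even and the three Walsh sums
-- are ± 2^(n/2); Fourier inversion gives 4 |F⁻¹(β)| = 2^n + w (4 [β = α] - 1)
-- with w = ± 2^(n/2), the sign being the product of the three signs.
-- For existence, direct sums of bent functions are bent and multiply the
-- parameters w, so it suffices to exhibit both signs in dimensions 4 and 6.
module Submission where

open import Defs
open import Data.Bool.Base using (Bool; true; false; _∧_; _xor_; if_then_else_)
open import Data.Bool.Properties using (∧-comm; xor-comm; xor-assoc; xor-same; xor-identityʳ)
open import Data.Integer.Base as ℤ using (ℤ; +_; -[1+_]; 0ℤ; 1ℤ; -1ℤ; _+_; _*_; _-_; -_)
import Data.Integer.Properties as ℤ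
open import Data.Integer.Tactic.RingSolver using (solve-∀)
open import Data.List.Base as List using ([]; _∷_; map; filter; length)
open import Data.List.Properties using (length-++; filter-++)
open import Data.Nat.Base as ℕ using (ℕ; zero; suc; _≤_; z≤n; s≤s)
open import Data.Nat.Coprimality as Coprime using (Coprime)
open import Data.Nat.Divisibility using (_∣_; divides; divides-refl)
open import Data.Nat.Primality using (euclidsLemma; prime[2])
import Data.Nat.Properties as ℕ
import Data.Nat.Tactic.RingSolver as ℕ-Solver
open import Data.Product.Base using (Σ-syntax; ∃; _×_; _,_; proj₁; proj₂)
open import Data.Rational.Base as ℚ using (ℚ; mkℚ)
import Data.Rational.Properties as ℚ
open import Data.Rational.Solver using (module +-*-Solver)
open import Data.Sum.Base using (_⊎_; inj₁; inj₂; reduce)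
open import Data.Vec.Base using ([]; _∷_; _++_; take; drop)
open import Data.Vec.Properties using (zipWith-comm; zipWith-assoc; zipWith-identityʳ; take++drop≡id)
open import Function.Base using (_∘_)
open import Function.Bundles using (mk⇔)
open import Level using (0ℓ)
open import Relation.Binary.PropositionalEquality
open import Relation.Nullary.Decidable using (Dec; yes; no; does; map′; _×-dec_; _→-dec_; ¬?; from-yes; does-⇔; dec-true; dec-false)
open import Relation.Nullary.Negation using (¬_; contradiction)
open import Relation.Unary using (Pred; Decidable)

private variable
  m n p : ℕ

-- Lets finite checks, such as the sign identity and the bentness of the small examples, be settled
-- by evaluation with `from-yes`.
∀? : {P : Pred (𝔽₂^ n) 0ℓ} → Decidable P → Dec (∀ x → P x)
∀? {zero}  P? = map′ (λ { h [] → h }) (λ h → h []) (P? [])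
∀? {suc n} P? = map′
  (λ { (h , _) (false ∷ x) → h x ; (_ , h) (true ∷ x) → h x })
  (λ h → (λ x → h (false ∷ x)) , (λ x → h (true ∷ x)))
  (∀? (λ x → P? (false ∷ x)) ×-dec ∀? (λ x → P? (true ∷ x)))

-- The additive group 𝔽₂^n.

⊕-comm : ∀ (x y : 𝔽₂^ n) → x ⊕ y ≡ y ⊕ x
⊕-comm = zipWith-comm xor-comm

⊕-assoc : ∀ (x y z : 𝔽₂^ n) → (x ⊕ y) ⊕ z ≡ x ⊕ (y ⊕ z)
⊕-assoc = zipWith-assoc xor-assoc

⊕-identityʳ : ∀ (x : 𝔽₂^ n) → x ⊕ 𝟎 ≡ x
⊕-identityʳ = zipWith-identityʳ xor-identityʳ

⊕-self : ∀ (x : 𝔽₂^ n) → x ⊕ x ≡ 𝟎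
⊕-self []      = refl
⊕-self (b ∷ x) = cong₂ _∷_ (xor-same b) (⊕-self x)

⊕-cancelʳ : ∀ (x y : 𝔽₂^ n) → (x ⊕ y) ⊕ y ≡ x
⊕-cancelʳ x y = begin
  (x ⊕ y) ⊕ y  ≡⟨ ⊕-assoc x y y ⟩
  x ⊕ (y ⊕ y)  ≡⟨ cong (x ⊕_) (⊕-self y) ⟩
  x ⊕ 𝟎        ≡⟨ ⊕-identityʳ x ⟩
  x            ∎
  where open ≡-Reasoning

⊕-interchange : ∀ (x y z w : 𝔽₂^ n) → (x ⊕ y) ⊕ (z ⊕ w) ≡ (x ⊕ z) ⊕ (y ⊕ w)
⊕-interchange x y z w = begin
  (x ⊕ y) ⊕ (z ⊕ w)  ≡⟨ ⊕-assoc x y (z ⊕ w) ⟩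
  x ⊕ (y ⊕ (z ⊕ w))  ≡⟨ cong (x ⊕_) (sym (⊕-assoc y z w)) ⟩
  x ⊕ ((y ⊕ z) ⊕ w)  ≡⟨ cong (λ u → x ⊕ (u ⊕ w)) (⊕-comm y z) ⟩
  x ⊕ ((z ⊕ y) ⊕ w)  ≡⟨ cong (x ⊕_) (⊕-assoc z y w) ⟩
  x ⊕ (z ⊕ (y ⊕ w))  ≡⟨ sym (⊕-assoc x z (y ⊕ w)) ⟩
  (x ⊕ z) ⊕ (y ⊕ w)  ∎
  where open ≡-Reasoning

-- Sums over 𝔽₂^n

pow : ℕ → ℤ
pow n = + (2 ℕ.^ n)

pow-suc : ∀ n → pow (suc n) ≡ + 2 * pow n
pow-suc n = ℤ.pos-* 2 (2 ℕ.^ n)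

pow-+ : ∀ p n → pow (p ℕ.+ n) ≡ pow p * pow n
pow-+ p n = trans (cong +_ (ℕ.^-distribˡ-+-* 2 p n)) (ℤ.pos-* (2 ℕ.^ p) (2 ℕ.^ n))

pow-cancelˡ : ∀ n {i j} → pow n * i ≡ pow n * j → i ≡ j
pow-cancelˡ n {i} {j} = ℤ.*-cancelˡ-≡ (pow n) i j {{ℕ.m^n≢0 2 n}}

-- Recursion on the dimension rather than a sum over `vectors n`, so that identities follow by
-- splitting off the first coordinate; `card-∑` connects it with list lengths.
∑ : (𝔽₂^ n → ℤ) → ℤ
∑ {zero}  f = f []
∑ {suc n} f = ∑ (λ x → f (false ∷ x)) + ∑ (λ x → f (true ∷ x))

∑-cong : {f g : 𝔽₂^ n → ℤ} → (∀ x → f x ≡ g x) → ∑ f ≡ ∑ g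
∑-cong {zero}  f≗g = f≗g []
∑-cong {suc n} f≗g = cong₂ _+_ (∑-cong (λ x → f≗g (false ∷ x))) (∑-cong (λ x → f≗g (true ∷ x)))

+-interchange : ∀ a b c d → (a + b) + (c + d) ≡ (a + c) + (b + d)
+-interchange = solve-∀

∑-distrib-+ : ∀ (f g : 𝔽₂^ n → ℤ) → ∑ (λ x → f x + g x) ≡ ∑ f + ∑ g
∑-distrib-+ {zero}  f g = refl
∑-distrib-+ {suc n} f g = trans
  (cong₂ _+_ (∑-distrib-+ (f ∘ (false ∷_)) (g ∘ (false ∷_))) (∑-distrib-+ (f ∘ (true ∷_)) (g ∘ (true ∷_))))
  (+-interchange (∑ (f ∘ (false ∷_))) (∑ (g ∘ (false ∷_))) (∑ (f ∘ (true ∷_))) (∑ (g ∘ (true ∷_))))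

*-distribˡ-∑ : ∀ c (f : 𝔽₂^ n → ℤ) → c * ∑ f ≡ ∑ (λ x → c * f x)
*-distribˡ-∑ {zero}  c f = refl
*-distribˡ-∑ {suc n} c f = trans
  (ℤ.*-distribˡ-+ c (∑ (f ∘ (false ∷_))) (∑ (f ∘ (true ∷_))))
  (cong₂ _+_ (*-distribˡ-∑ c (f ∘ (false ∷_))) (*-distribˡ-∑ c (f ∘ (true ∷_))))

∑-const : ∀ n c → ∑ {n} (λ _ → c) ≡ pow n * c
∑-const zero    c = sym (ℤ.*-identityˡ c)
∑-const (suc n) c = begin
  ∑ {n} (λ _ → c) + ∑ {n} (λ _ → c)  ≡⟨ cong₂ _+_ (∑-const n c) (∑-const n c) ⟩
  pow n * c + pow n * c              ≡⟨ double (pow n) c ⟩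
  (+ 2 * pow n) * c                  ≡⟨ cong (_* c) (sym (pow-suc n)) ⟩
  pow (suc n) * c                    ∎
  where
  open ≡-Reasoning
  double : ∀ a b → a * b + a * b ≡ (+ 2 * a) * b
  double = solve-∀

∑-comm : ∀ (f : 𝔽₂^ m → 𝔽₂^ n → ℤ) → ∑ (λ x → ∑ (f x)) ≡ ∑ (λ y → ∑ (λ x → f x y))
∑-comm {zero}  f = refl
∑-comm {suc m} f = trans
  (cong₂ _+_ (∑-comm (f ∘ (false ∷_))) (∑-comm (f ∘ (true ∷_))))
  (sym (∑-distrib-+ (λ y → ∑ (λ x → f (false ∷ x) y)) (λ y → ∑ (λ x → f (true ∷ x) y))))

-- A leading bit `true` in `a` merely swaps the two halves of the sum.
∑-translate : ∀ a (f : 𝔽₂^ n → ℤ) → ∑ (λ x → f (x ⊕ a)) ≡ ∑ f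
∑-translate []          f = refl
∑-translate (false ∷ a) f = cong₂ _+_ (∑-translate a (f ∘ (false ∷_))) (∑-translate a (f ∘ (true ∷_)))
∑-translate (true ∷ a)  f = trans
  (cong₂ _+_ (∑-translate a (f ∘ (true ∷_))) (∑-translate a (f ∘ (false ∷_))))
  (ℤ.+-comm (∑ (f ∘ (true ∷_))) (∑ (f ∘ (false ∷_))))

∑-++ : ∀ p (f : 𝔽₂^ (p ℕ.+ n) → ℤ) → ∑ f ≡ ∑ (λ (x : 𝔽₂^ p) → ∑ (λ y → f (x ++ y)))
∑-++ zero    f = refl
∑-++ (suc p) f = cong₂ _+_ (∑-++ p (f ∘ (false ∷_))) (∑-++ p (f ∘ (true ∷_)))

⟦_⟧ : Bool → ℤ
⟦ b ⟧ = if b then 1ℤ else 0ℤ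

δ : 𝔽₂^ n → 𝔽₂^ n → ℤ
δ x y = ⟦ does (x ≟ y) ⟧

δ-same : ∀ (x : 𝔽₂^ n) → δ x x ≡ 1ℤ
δ-same x = cong ⟦_⟧ (dec-true (x ≟ x) refl)

δ-distinct : ∀ {x y : 𝔽₂^ n} → x ≢ y → δ x y ≡ 0ℤ
δ-distinct {x = x} {y} x≢y = cong ⟦_⟧ (dec-false (x ≟ y) x≢y)

δ-shift : ∀ (x y z : 𝔽₂^ n) → δ (x ⊕ y) z ≡ δ x (z ⊕ y)
δ-shift x y z = cong ⟦_⟧ (does-⇔
  (mk⇔ (λ e → trans (sym (⊕-cancelʳ x y)) (cong (_⊕ y) e))
       (λ e → trans (cong (_⊕ y) e) (⊕-cancelʳ z y)))
  ((x ⊕ y) ≟ z) (x ≟ (z ⊕ y)))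

∑-zero : ∀ (f : 𝔽₂^ n → ℤ) → ∑ (λ x → f x * 0ℤ) ≡ 0ℤ
∑-zero {n} f = trans (∑-cong (λ x → ℤ.*-zeroʳ (f x))) (trans (∑-const n 0ℤ) (ℤ.*-zeroʳ (pow n)))

-- In the half whose leading bit differs from that of `v`, `δ` reduces to `0ℤ` by computation, so
-- `∑-zero` applies there.
∑-δ : ∀ v (f : 𝔽₂^ n → ℤ) → ∑ (λ x → f x * δ v x) ≡ f v
∑-δ []          f = ℤ.*-identityʳ (f [])
∑-δ (false ∷ v) f = trans
  (cong₂ _+_ (∑-δ v (f ∘ (false ∷_))) (∑-zero (f ∘ (true ∷_)))) (ℤ.+-identityʳ _)
∑-δ (true ∷ v)  f = trans
  (cong₂ _+_ (∑-zero (f ∘ (false ∷_))) (∑-δ v (f ∘ (true ∷_)))) (ℤ.+-identityˡ _)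

♯ : (𝔽₂^ n → 𝔽₂^ m) → 𝔽₂^ m → ℤ
♯ F β = ∑ (λ x → δ (F x) β)

length-filter-map : ∀ {A B : Set} {P : Pred B 0ℓ} (P? : Decidable P) (f : A → B) xs →
  length (filter P? (map f xs)) ≡ length (filter (λ x → P? (f x)) xs)
length-filter-map P? f []       = refl
length-filter-map P? f (x ∷ xs) with does (P? (f x))
... | true  = cong suc (length-filter-map P? f xs)
... | false = length-filter-map P? f xs

card-∑ : {P : Pred (𝔽₂^ n) 0ℓ} (P? : Decidable P) → + ∣ P? ∣ ≡ ∑ (λ x → ⟦ does (P? x) ⟧)
card-∑ {zero}  P? with does (P? [])
... | true  = refl
... | false = refl
card-∑ {suc n} P? = begin
  + length (filter P? (map (false ∷_) (vectors n) List.++ map (true ∷_) (vectors n)))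
    ≡⟨ cong (+_ ∘ length) (filter-++ P? (map (false ∷_) (vectors n)) (map (true ∷_) (vectors n))) ⟩
  + length (filter P? (map (false ∷_) (vectors n)) List.++ filter P? (map (true ∷_) (vectors n)))
    ≡⟨ cong +_ (length-++ (filter P? (map (false ∷_) (vectors n)))) ⟩
  + length (filter P? (map (false ∷_) (vectors n))) + + length (filter P? (map (true ∷_) (vectors n)))
    ≡⟨ cong₂ (λ i j → + i + + j) (length-filter-map P? (false ∷_) (vectors n)) (length-filter-map P? (true ∷_) (vectors n)) ⟩
  + ∣ (λ x → P? (false ∷ x)) ∣ + + ∣ (λ x → P? (true ∷ x)) ∣
    ≡⟨ cong₂ _+_ (card-∑ (λ x → P? (false ∷ x))) (card-∑ (λ x → P? (true ∷ x))) ⟩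
  ∑ (λ x → ⟦ does (P? x) ⟧) ∎
  where open ≡-Reasoning

-- Summation over the fibres of `D`: expand each value of `h` against `δ` and exchange the sums.
∑-pushforward : ∀ (D : 𝔽₂^ n → 𝔽₂^ m) (h : 𝔽₂^ m → ℤ) → ∑ (λ x → h (D x)) ≡ ∑ (λ b → h b * ♯ D b)
∑-pushforward D h = begin
  ∑ (λ x → h (D x))                       ≡⟨ ∑-cong (λ x → sym (∑-δ (D x) h)) ⟩
  ∑ (λ x → ∑ (λ b → h b * δ (D x) b))     ≡⟨ ∑-comm (λ x b → h b * δ (D x) b) ⟩
  ∑ (λ b → ∑ (λ x → h b * δ (D x) b))     ≡⟨ ∑-cong (λ b → sym (*-distribˡ-∑ (h b) (λ x → δ (D x) b))) ⟩
  ∑ (λ b → h b * ♯ D b)                   ∎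
  where open ≡-Reasoning

-- Characters and the Walsh transform

sgn : Bool → ℤ
sgn b = if b then -1ℤ else 1ℤ

-- The character v ↦ (-1)^(u·v), with u·v the dot product over 𝔽₂.
χ : 𝔽₂^ n → 𝔽₂^ n → ℤ
χ []      []      = 1ℤ
χ (l ∷ u) (b ∷ v) = sgn (l ∧ b) * χ u v

sgn-∧-xor : ∀ l b c → sgn (l ∧ (b xor c)) ≡ sgn (l ∧ b) * sgn (l ∧ c)
sgn-∧-xor false b     c     = refl
sgn-∧-xor true  false false = refl
sgn-∧-xor true  false true  = refl
sgn-∧-xor true  true  false = refl
sgn-∧-xor true  true  true  = refl

*-interchange : ∀ a b c d → (a * b) * (c * d) ≡ (a * c) * (b * d)
*-interchange = solve-∀

χ-⊕ : ∀ (u v w : 𝔽₂^ n) → χ u (v ⊕ w) ≡ χ u v * χ u w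
χ-⊕ []      []      []      = refl
χ-⊕ (l ∷ u) (b ∷ v) (c ∷ w) = trans
  (cong₂ _*_ (sgn-∧-xor l b c) (χ-⊕ u v w))
  (*-interchange (sgn (l ∧ b)) (sgn (l ∧ c)) (χ u v) (χ u w))

χ-comm : ∀ (u v : 𝔽₂^ n) → χ u v ≡ χ v u
χ-comm []      []      = refl
χ-comm (l ∷ u) (b ∷ v) = cong₂ _*_ (cong sgn (∧-comm l b)) (χ-comm u v)

χ-𝟎 : ∀ (v : 𝔽₂^ n) → χ 𝟎 v ≡ 1ℤ
χ-𝟎 []      = refl
χ-𝟎 (b ∷ v) = trans (ℤ.*-identityˡ (χ 𝟎 v)) (χ-𝟎 v)

χ-square : ∀ (u v : 𝔽₂^ n) → χ u v * χ u v ≡ 1ℤ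
χ-square u v = begin
  χ u v * χ u v  ≡⟨ sym (χ-⊕ u v v) ⟩
  χ u (v ⊕ v)    ≡⟨ cong (χ u) (⊕-self v) ⟩
  χ u 𝟎          ≡⟨ χ-comm u 𝟎 ⟩
  χ 𝟎 u          ≡⟨ χ-𝟎 u ⟩
  1ℤ             ∎
  where open ≡-Reasoning

-- The two halves of the sum differ by the factor `sgn b`: they add up for `b = false` and cancel
-- for `b = true`.
χ-orthogonality : ∀ (v : 𝔽₂^ n) → ∑ (λ u → χ u v) ≡ pow n * δ v 𝟎
χ-orthogonality []              = refl
χ-orthogonality {suc n} (b ∷ v) = begin
  ∑ (λ u → 1ℤ * χ u v) + ∑ (λ u → sgn b * χ u v)
    ≡⟨ cong₂ _+_ (sym (*-distribˡ-∑ 1ℤ (λ u → χ u v))) (sym (*-distribˡ-∑ (sgn b) (λ u → χ u v))) ⟩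
  1ℤ * ∑ (λ u → χ u v) + sgn b * ∑ (λ u → χ u v)
    ≡⟨ cong (λ s → 1ℤ * s + sgn b * s) (χ-orthogonality v) ⟩
  1ℤ * (pow n * δ v 𝟎) + sgn b * (pow n * δ v 𝟎)
    ≡⟨ step b ⟩
  (+ 2 * pow n) * δ (b ∷ v) 𝟎
    ≡⟨ cong (_* δ (b ∷ v) 𝟎) (sym (pow-suc n)) ⟩
  pow (suc n) * δ (b ∷ v) 𝟎 ∎
  where
  open ≡-Reasoning
  even : ∀ a d → 1ℤ * (a * d) + 1ℤ * (a * d) ≡ (+ 2 * a) * d
  even = solve-∀
  odd : ∀ a d → 1ℤ * (a * d) + -1ℤ * (a * d) ≡ (+ 2 * a) * 0ℤ
  odd = solve-∀
  step : ∀ b → 1ℤ * (pow n * δ v 𝟎) + sgn b * (pow n * δ v 𝟎) ≡ (+ 2 * pow n) * δ (b ∷ v) 𝟎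
  step false = even (pow n) (δ v 𝟎)
  step true  = odd (pow n) (δ v 𝟎)

-- Derivatives and Walsh sums of bent functions.

∂ : 𝔽₂^ n → (𝔽₂^ n → 𝔽₂^ m) → 𝔽₂^ n → 𝔽₂^ m
∂ a F x = F (x ⊕ a) ⊖ F x

-- `Bent` with denominators cleared, so that the argument stays in ℤ.
IsBent : (𝔽₂^ n → 𝔽₂^ m) → Set
IsBent {n} {m} F = ∀ a → a ≢ 𝟎 → ∀ b → pow m * ♯ (∂ a F) b ≡ pow n

-- The Walsh transform of the component function u·F at frequency zero; preimage sizes involve no
-- other frequency.
walsh : (𝔽₂^ n → 𝔽₂^ m) → 𝔽₂^ m → ℤ
walsh F u = ∑ (λ x → χ u (F x))

walsh-𝟎 : ∀ (F : 𝔽₂^ n → 𝔽₂^ m) → walsh F 𝟎 ≡ pow n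
walsh-𝟎 {n} F = trans (∑-cong (λ x → χ-𝟎 (F x))) (trans (∑-const n 1ℤ) (ℤ.*-identityʳ (pow n)))

-- For a = 0 the derivative vanishes and every summand is 1. For a ≠ 0 it takes all values equally
-- often, so the sum is a multiple of a full character sum, which is 0 because u ≠ 0.
∑-χ-∂ : ∀ {F : 𝔽₂^ n → 𝔽₂^ m} → IsBent F → ∀ u → u ≢ 𝟎 → ∀ a →
  ∑ (λ x → χ u (∂ a F x)) ≡ pow n * δ 𝟎 a
∑-χ-∂ {n} {m} {F} bent u u≢𝟎 a with a ≟ 𝟎
... | yes refl = begin
  ∑ (λ x → χ u (F (x ⊕ 𝟎) ⊖ F x))   ≡⟨ ∑-cong (λ x → cong (λ y → χ u (F y ⊖ F x)) (⊕-identityʳ x)) ⟩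
  ∑ (λ x → χ u (F x ⊕ F x))         ≡⟨ ∑-cong (λ x → trans (χ-⊕ u (F x) (F x)) (χ-square u (F x))) ⟩
  ∑ {n} (λ x → 1ℤ)                  ≡⟨ ∑-const n 1ℤ ⟩
  pow n * 1ℤ                        ≡⟨ cong (pow n *_) (sym (δ-same (𝟎 {n}))) ⟩
  pow n * δ (𝟎 {n}) 𝟎               ∎
  where open ≡-Reasoning
... | no a≢𝟎 = pow-cancelˡ m (begin
  pow m * ∑ (λ x → χ u (∂ a F x))             ≡⟨ cong (pow m *_) (∑-pushforward (∂ a F) (χ u)) ⟩
  pow m * ∑ (λ b → χ u b * ♯ (∂ a F) b)       ≡⟨ *-distribˡ-∑ (pow m) (λ b → χ u b * ♯ (∂ a F) b) ⟩
  ∑ (λ b → pow m * (χ u b * ♯ (∂ a F) b))     ≡⟨ ∑-cong (λ b → trans (rotate (pow m) (χ u b) (♯ (∂ a F) b)) (cong₂ _*_ (bent a a≢𝟎 b) (χ-comm u b))) ⟩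
  ∑ (λ b → pow n * χ b u)                     ≡⟨ sym (*-distribˡ-∑ (pow n) (λ b → χ b u)) ⟩
  pow n * ∑ (λ b → χ b u)                     ≡⟨ cong (pow n *_) (χ-orthogonality u) ⟩
  pow n * (pow m * δ u 𝟎)                     ≡⟨ cong (λ d → pow n * (pow m * d)) (δ-distinct u≢𝟎) ⟩
  pow n * (pow m * 0ℤ)                        ≡⟨ rotate′ (pow n) (pow m) ⟩
  pow m * (pow n * 0ℤ)                        ≡⟨ cong (λ d → pow m * (pow n * d)) (sym (δ-distinct (a≢𝟎 ∘ sym))) ⟩
  pow m * (pow n * δ 𝟎 a)                     ∎)
  where
  open ≡-Reasoning
  rotate : ∀ x y z → x * (y * z) ≡ (x * z) * y
  rotate = solve-∀
  rotate′ : ∀ x y → x * (y * 0ℤ) ≡ y * (x * 0ℤ)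
  rotate′ = solve-∀

walsh-square : ∀ {F : 𝔽₂^ n → 𝔽₂^ m} → IsBent F → ∀ u → u ≢ 𝟎 → walsh F u * walsh F u ≡ pow n
walsh-square {n} {m} {F} bent u u≢𝟎 = begin
  walsh F u * walsh F u                        ≡⟨ *-distribˡ-∑ (walsh F u) g ⟩
  ∑ (λ x → walsh F u * g x)                    ≡⟨ ∑-cong (λ x → trans (ℤ.*-comm (walsh F u) (g x)) (*-distribˡ-∑ (g x) g)) ⟩
  -- Substituting y = a + x in the inner sum makes each product of values a character of the
  -- derivative in direction `a`.
  ∑ (λ x → ∑ (λ y → g x * g y))                ≡⟨ ∑-cong (λ x → sym (∑-translate x (λ y → g x * g y))) ⟩
  ∑ (λ x → ∑ (λ a → g x * g (a ⊕ x)))          ≡⟨ ∑-cong (λ x → ∑-cong (λ a → merge x a)) ⟩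
  ∑ (λ x → ∑ (λ a → χ u (∂ a F x)))            ≡⟨ ∑-comm (λ x a → χ u (∂ a F x)) ⟩
  ∑ (λ a → ∑ (λ x → χ u (∂ a F x)))            ≡⟨ ∑-cong (∑-χ-∂ {F = F} bent u u≢𝟎) ⟩
  ∑ (λ (a : 𝔽₂^ n) → pow n * δ 𝟎 a)           ≡⟨ ∑-δ (𝟎 {n}) (λ _ → pow n) ⟩
  pow n                                        ∎
  where
  open ≡-Reasoning
  g : 𝔽₂^ n → ℤ
  g x = χ u (F x)
  merge : ∀ x a → g x * g (a ⊕ x) ≡ χ u (∂ a F x)
  merge x a = begin
    g x * g (a ⊕ x)         ≡⟨ ℤ.*-comm (g x) (g (a ⊕ x)) ⟩
    g (a ⊕ x) * g x         ≡⟨ cong (λ y → g y * g x) (⊕-comm a x) ⟩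
    g (x ⊕ a) * g x         ≡⟨ sym (χ-⊕ u (F (x ⊕ a)) (F x)) ⟩
    χ u (∂ a F x)           ∎

-- Orthogonality at `F x ⊕ β` expands the indicator of F x = β into characters; exchanging the sums
-- collects the Walsh sums.
walsh-inversion : ∀ (F : 𝔽₂^ n → 𝔽₂^ m) β → pow m * ♯ F β ≡ ∑ (λ u → χ u β * walsh F u)
walsh-inversion {n} {m} F β = begin
  pow m * ♯ F β                                 ≡⟨ *-distribˡ-∑ (pow m) (λ x → δ (F x) β) ⟩
  ∑ (λ x → pow m * δ (F x) β)                   ≡⟨ ∑-cong expand ⟩
  ∑ (λ x → ∑ (λ u → χ u β * χ u (F x)))         ≡⟨ ∑-comm (λ x u → χ u β * χ u (F x)) ⟩
  ∑ (λ u → ∑ (λ x → χ u β * χ u (F x)))         ≡⟨ ∑-cong (λ u → sym (*-distribˡ-∑ (χ u β) (λ x → χ u (F x)))) ⟩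
  ∑ (λ u → χ u β * walsh F u)                   ∎
  where
  open ≡-Reasoning
  expand : ∀ x → pow m * δ (F x) β ≡ ∑ (λ u → χ u β * χ u (F x))
  expand x = begin
    pow m * δ (F x) β                  ≡⟨ cong (λ y → pow m * δ y β) (sym (⊕-cancelʳ (F x) β)) ⟩
    pow m * δ ((F x ⊕ β) ⊕ β) β        ≡⟨ cong (pow m *_) (δ-shift (F x ⊕ β) β β) ⟩
    pow m * δ (F x ⊕ β) (β ⊕ β)        ≡⟨ cong (λ y → pow m * δ (F x ⊕ β) y) (⊕-self β) ⟩
    pow m * δ (F x ⊕ β) 𝟎              ≡⟨ sym (χ-orthogonality (F x ⊕ β)) ⟩
    ∑ (λ u → χ u (F x ⊕ β))            ≡⟨ ∑-cong (λ u → trans (χ-⊕ u (F x) β) (ℤ.*-comm (χ u (F x)) (χ u β))) ⟩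
    ∑ (λ u → χ u β * χ u (F x))        ∎

-- Square roots of powers of two.

-- Descent by two in the exponent: by Euclid's lemma the root is even, and a factor 4 cancels. This
-- is what forces n to be even for a bent function.
square-root-of-pow : ∀ n m → m ℕ.* m ≡ 2 ℕ.^ n → Σ[ k ∈ ℕ ] (n ≡ k ℕ.* 2 × m ≡ 2 ℕ.^ k)
square-root-of-pow zero          m eq = 0 , refl , ℕ.m*n≡1⇒m≡1 m m eq
-- Exponent 1: the roots 0 and 1 are refuted by computation, and a root of at least 2 has a square
-- of at least 4.
square-root-of-pow (suc zero)    (suc (suc m)) eq =
  contradiction (ℕ.*-mono-≤ {2} {suc (suc m)} {2} {suc (suc m)} (s≤s (s≤s z≤n)) (s≤s (s≤s z≤n)))
    (subst (λ i → ¬ (4 ≤ i)) (sym eq) λ { (s≤s (s≤s ())) })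
square-root-of-pow (suc (suc n)) m eq
  with reduce (euclidsLemma m m prime[2]
         (divides (2 ℕ.* 2 ℕ.^ n) (trans eq (ℕ.*-comm 2 (2 ℕ.* 2 ℕ.^ n)))))
... | divides q refl
  with square-root-of-pow n q (ℕ.*-cancelˡ-≡ (q ℕ.* q) (2 ℕ.^ n) 4
         (trans (quadruple q) (trans eq (sym (ℕ.*-assoc 2 2 (2 ℕ.^ n))))))
  where
  quadruple : ∀ q → 4 ℕ.* (q ℕ.* q) ≡ (q ℕ.* 2) ℕ.* (q ℕ.* 2)
  quadruple = ℕ-Solver.solve-∀
...   | k , refl , refl = suc k , refl , ℕ.*-comm (2 ℕ.^ k) 2

abs-square : ∀ n w → w * w ≡ pow n → ℤ.∣ w ∣ ℕ.* ℤ.∣ w ∣ ≡ 2 ℕ.^ n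
abs-square n w eq = trans (sym (ℤ.abs-* w w)) (cong ℤ.∣_∣ eq)

signed-root : ∀ k w → w * w ≡ pow (k ℕ.* 2) → Σ[ s ∈ Bool ] w ≡ sgn s * pow k
signed-root k w eq with square-root-of-pow (k ℕ.* 2) ℤ.∣ w ∣ (abs-square (k ℕ.* 2) w eq)
... | j , k*2≡j*2 , ∣w∣≡2^j = sign w (trans ∣w∣≡2^j (cong (2 ℕ.^_) (sym (ℕ.*-cancelʳ-≡ k j 2 k*2≡j*2))))
  where
  sign : ∀ w → ℤ.∣ w ∣ ≡ 2 ℕ.^ k → Σ[ s ∈ Bool ] w ≡ sgn s * pow k
  sign (+ i)    e = false , trans (cong +_ e) (sym (ℤ.*-identityˡ (pow k)))
  sign -[1+ i ] e = true , trans (cong (-_ ∘ +_) e) (sym (ℤ.-1*i≡-i (pow k)))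

-- From Walsh signs to preimage distributions.

-- With w = 2^(n/2) and w = - 2^(n/2) these are the types (+) and (-): four
-- times the size of the preimage of β is 2^n + 3 w for β ≡ α and 2^n - w otherwise.
HasType : ℤ → (𝔽₂^ n → 𝔽₂^ 2) → 𝔽₂^ 2 → Set
HasType {n} w F α = ∀ β → + 4 * ♯ F β ≡ pow n + w * (+ 4 * δ β α - 1ℤ)

-- If the product of the three signs is 1, they are the values of a character
-- at α; otherwise their negatives are.
SignPattern : 𝔽₂^ 3 → 𝔽₂^ 2 → Set
SignPattern (s₁ ∷ s₂ ∷ s₃ ∷ []) β =
  χ (false ∷ true ∷ []) β * sgn s₁
    + (χ (true ∷ false ∷ []) β * sgn s₂ + χ (true ∷ true ∷ []) β * sgn s₃)
    ≡ sgn (s₁ xor (s₂ xor s₃)) * (+ 4 * δ β α - 1ℤ)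
  where α = (s₁ xor s₃) ∷ (s₂ xor s₃) ∷ []

-- If the signs are the values of a character at α, the left side sums χ u (β ⊕ α) over the nonzero
-- u, which is 4δ - 1 by orthogonality. All 8 · 4 cases are checked by evaluation.
sign-pattern : ∀ s β → SignPattern s β
sign-pattern = from-yes (∀? λ s → ∀? (sign-pattern? s))
  where
  sign-pattern? : ∀ s β → Dec (SignPattern s β)
  sign-pattern? (_ ∷ _ ∷ _ ∷ []) β = _ ℤ.≟ _

-- In the inversion formula the trivial character contributes `pow n`, and `sign-pattern` evaluates
-- the other three terms.
walsh⇒type : ∀ (F : 𝔽₂^ n → 𝔽₂^ 2) w s₁ s₂ s₃ →
  walsh F (false ∷ true ∷ []) ≡ sgn s₁ * w →
  walsh F (true ∷ false ∷ []) ≡ sgn s₂ * w →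
  walsh F (true ∷ true ∷ []) ≡ sgn s₃ * w →
  HasType (sgn (s₁ xor (s₂ xor s₃)) * w) F ((s₁ xor s₃) ∷ (s₂ xor s₃) ∷ [])
walsh⇒type {n} F w s₁ s₂ s₃ e₁ e₂ e₃ β = begin
  + 4 * ♯ F β
    ≡⟨ walsh-inversion F β ⟩
  (χ 𝟎 β * walsh F 𝟎 + χ₁ * walsh F (false ∷ true ∷ []))
    + (χ₂ * walsh F (true ∷ false ∷ []) + χ₃ * walsh F (true ∷ true ∷ []))
    ≡⟨ cong₂ _+_
         (cong₂ _+_ (trans (cong₂ _*_ (χ-𝟎 β) (walsh-𝟎 F)) (ℤ.*-identityˡ (pow n))) (cong (χ₁ *_) e₁))
         (cong₂ _+_ (cong (χ₂ *_) e₂) (cong (χ₃ *_) e₃)) ⟩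
  (pow n + χ₁ * (sgn s₁ * w)) + (χ₂ * (sgn s₂ * w) + χ₃ * (sgn s₃ * w))
    ≡⟨ collect (pow n) w χ₁ χ₂ χ₃ (sgn s₁) (sgn s₂) (sgn s₃) ⟩
  pow n + w * (χ₁ * sgn s₁ + (χ₂ * sgn s₂ + χ₃ * sgn s₃))
    ≡⟨ cong (λ i → pow n + w * i) (sign-pattern (s₁ ∷ s₂ ∷ s₃ ∷ []) β) ⟩
  pow n + w * (sgn s * (+ 4 * δ β α - 1ℤ))
    ≡⟨ cong (λ i → pow n + i) (reassociate w (sgn s) (+ 4 * δ β α - 1ℤ)) ⟩
  pow n + (sgn s * w) * (+ 4 * δ β α - 1ℤ) ∎
  where
  open ≡-Reasoning
  s = s₁ xor (s₂ xor s₃)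
  -- If the product of the signs is 1, then s₃ = s₁ xor s₂ and α = (s₂, s₁), where the characters
  -- 01, 10, 11 take the values `sgn s₁`, `sgn s₂`, `sgn s₃`. Otherwise both bits of α are the
  -- complements of these, and all three values change sign.
  α = (s₁ xor s₃) ∷ (s₂ xor s₃) ∷ []
  χ₁ = χ (false ∷ true ∷ []) β
  χ₂ = χ (true ∷ false ∷ []) β
  χ₃ = χ (true ∷ true ∷ []) β
  collect : ∀ q w x y z a b c →
    (q + x * (a * w)) + (y * (b * w) + z * (c * w)) ≡ q + w * (x * a + (y * b + z * c))
  collect = solve-∀
  reassociate : ∀ w s d → w * (s * d) ≡ (s * w) * d
  reassociate = solve-∀

bent⇒type : ∀ (F : 𝔽₂^ n → 𝔽₂^ 2) → IsBent F →
  Σ[ k ∈ ℕ ] (n ≡ k ℕ.* 2 × Σ[ s ∈ Bool ] ∃ (HasType (sgn s * pow k) F))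
bent⇒type {n} F bent
  with square-root-of-pow n ℤ.∣ walsh F (false ∷ true ∷ []) ∣
         (abs-square n (walsh F (false ∷ true ∷ [])) (walsh-square {F = F} bent (false ∷ true ∷ []) λ ()))
-- One Walsh sum already determines n = 2k, so the same `k` serves for the signed roots of all
-- three.
... | k , refl , _
  with signed-root k (walsh F (false ∷ true ∷ [])) (walsh-square {F = F} bent (false ∷ true ∷ []) λ ())
     | signed-root k (walsh F (true ∷ false ∷ [])) (walsh-square {F = F} bent (true ∷ false ∷ []) λ ())
     | signed-root k (walsh F (true ∷ true ∷ [])) (walsh-square {F = F} bent (true ∷ true ∷ []) λ ())
... | s₁ , e₁ | s₂ , e₂ | s₃ , e₃ =
  k , refl , s₁ xor (s₂ xor s₃) , _ , walsh⇒type F (pow k) s₁ s₂ s₃ e₁ e₂ e₃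

-- Direct sums

infixr 5 _⊞_

_⊞_ : (𝔽₂^ p → 𝔽₂^ m) → (𝔽₂^ n → 𝔽₂^ m) → 𝔽₂^ (p ℕ.+ n) → 𝔽₂^ m
_⊞_ {p = p} F G z = F (take p z) ⊕ G (drop p z)

⊞-++ : ∀ (F : 𝔽₂^ p → 𝔽₂^ m) (G : 𝔽₂^ n → 𝔽₂^ m) x y → (F ⊞ G) (x ++ y) ≡ F x ⊕ G y
⊞-++ {p = p} F G x y = cong₂ (λ x y → F x ⊕ G y) (proj₁ (split x)) (proj₂ (split x))
  where
  split : ∀ {p} (x : 𝔽₂^ p) → take p (x ++ y) ≡ x × drop p (x ++ y) ≡ y
  split []      = refl , refl
  split (b ∷ x) = cong (b ∷_) (proj₁ (split x)) , proj₂ (split x)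

⊕-++ : ∀ (x x′ : 𝔽₂^ p) (y y′ : 𝔽₂^ n) → (x ++ y) ⊕ (x′ ++ y′) ≡ (x ⊕ x′) ++ (y ⊕ y′)
⊕-++ []      []        y y′ = refl
⊕-++ (b ∷ x) (b′ ∷ x′) y y′ = cong ((b xor b′) ∷_) (⊕-++ x x′ y y′)

𝟎-++ : ∀ p → 𝟎 {p} ++ 𝟎 {n} ≡ 𝟎
𝟎-++ zero    = refl
𝟎-++ (suc p) = cong (false ∷_) (𝟎-++ p)

♯-cong : {F G : 𝔽₂^ n → 𝔽₂^ m} → (∀ x → F x ≡ G x) → ∀ β → ♯ F β ≡ ♯ G β
♯-cong F≗G β = ∑-cong (λ x → cong (λ y → δ y β) (F≗G x))

-- The distribution of a direct sum is a convolution: for fixed x, the second summand must equal β -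
-- F x.
♯-⊞ : ∀ (F : 𝔽₂^ p → 𝔽₂^ m) (G : 𝔽₂^ n → 𝔽₂^ m) β → ♯ (F ⊞ G) β ≡ ∑ (λ x → ♯ G (β ⊕ F x))
♯-⊞ {p = p} F G β = trans (∑-++ p (λ z → δ ((F ⊞ G) z) β)) (∑-cong λ x → ∑-cong λ y → begin
  δ ((F ⊞ G) (x ++ y)) β   ≡⟨ cong (λ v → δ v β) (trans (⊞-++ F G x y) (⊕-comm (F x) (G y))) ⟩
  δ (G y ⊕ F x) β          ≡⟨ δ-shift (G y) (F x) β ⟩
  δ (G y) (β ⊕ F x)        ∎)
  where open ≡-Reasoning

♯-⊞-comm : ∀ (F : 𝔽₂^ p → 𝔽₂^ m) (G : 𝔽₂^ n → 𝔽₂^ m) β → ♯ (F ⊞ G) β ≡ ♯ (G ⊞ F) β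
♯-⊞-comm {p = p} {n = n} F G β = begin
  ♯ (F ⊞ G) β
    ≡⟨ ∑-++ p (λ z → δ ((F ⊞ G) z) β) ⟩
  ∑ (λ (x : 𝔽₂^ p) → ∑ (λ (y : 𝔽₂^ n) → δ ((F ⊞ G) (x ++ y)) β))
    ≡⟨ ∑-comm (λ (x : 𝔽₂^ p) (y : 𝔽₂^ n) → δ ((F ⊞ G) (x ++ y)) β) ⟩
  ∑ (λ (y : 𝔽₂^ n) → ∑ (λ (x : 𝔽₂^ p) → δ ((F ⊞ G) (x ++ y)) β))
    ≡⟨ ∑-cong (λ y → ∑-cong (λ x → cong (λ v → δ v β) (swap x y))) ⟩
  ∑ (λ (y : 𝔽₂^ n) → ∑ (λ (x : 𝔽₂^ p) → δ ((G ⊞ F) (y ++ x)) β))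
    ≡⟨ sym (∑-++ n (λ z → δ ((G ⊞ F) z) β)) ⟩
  ♯ (G ⊞ F) β ∎
  where
  open ≡-Reasoning
  swap : ∀ x y → (F ⊞ G) (x ++ y) ≡ (G ⊞ F) (y ++ x)
  swap x y = trans (⊞-++ F G x y) (trans (⊕-comm (F x) (G y)) (sym (⊞-++ G F y x)))

∂-⊞ : ∀ (F : 𝔽₂^ p → 𝔽₂^ m) (G : 𝔽₂^ n → 𝔽₂^ m) a b z → ∂ (a ++ b) (F ⊞ G) z ≡ (∂ a F ⊞ ∂ b G) z
∂-⊞ {p = p} F G a b z = subst (λ z → ∂ (a ++ b) (F ⊞ G) z ≡ (∂ a F ⊞ ∂ b G) z) (take++drop≡id p z) (begin
  (F ⊞ G) ((x ++ y) ⊕ (a ++ b)) ⊕ (F ⊞ G) (x ++ y)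
    ≡⟨ cong₂ (λ v w → (F ⊞ G) v ⊕ w) (⊕-++ x a y b) (⊞-++ F G x y) ⟩
  (F ⊞ G) ((x ⊕ a) ++ (y ⊕ b)) ⊕ (F x ⊕ G y)
    ≡⟨ cong (_⊕ (F x ⊕ G y)) (⊞-++ F G (x ⊕ a) (y ⊕ b)) ⟩
  (F (x ⊕ a) ⊕ G (y ⊕ b)) ⊕ (F x ⊕ G y)
    ≡⟨ ⊕-interchange (F (x ⊕ a)) (G (y ⊕ b)) (F x) (G y) ⟩
  ∂ a F x ⊕ ∂ b G y
    ≡⟨ sym (⊞-++ (∂ a F) (∂ b G) x y) ⟩
  (∂ a F ⊞ ∂ b G) (x ++ y) ∎)
  where
  open ≡-Reasoning
  x = take p z
  y = drop p z

-- Whatever `D` is, the convolution consists of 2^p equal terms once `E` is uniformly distributed.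
⊞-uniform : ∀ (D : 𝔽₂^ p → 𝔽₂^ m) (E : 𝔽₂^ n → 𝔽₂^ m) →
  (∀ b → pow m * ♯ E b ≡ pow n) → ∀ b → pow m * ♯ (D ⊞ E) b ≡ pow (p ℕ.+ n)
⊞-uniform {p} {m} {n} D E uniform b = begin
  pow m * ♯ (D ⊞ E) b                  ≡⟨ cong (pow m *_) (♯-⊞ D E b) ⟩
  pow m * ∑ (λ x → ♯ E (b ⊕ D x))      ≡⟨ *-distribˡ-∑ (pow m) (λ x → ♯ E (b ⊕ D x)) ⟩
  ∑ (λ x → pow m * ♯ E (b ⊕ D x))      ≡⟨ ∑-cong (λ x → uniform (b ⊕ D x)) ⟩
  ∑ {p} (λ _ → pow n)                  ≡⟨ ∑-const p (pow n) ⟩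
  pow p * pow n                        ≡⟨ sym (pow-+ p n) ⟩
  pow (p ℕ.+ n)                        ∎
  where open ≡-Reasoning

-- A nonzero direction has a nonzero half. The derivative of the corresponding summand is uniform,
-- and this carries over to the sum; `♯-⊞-comm` reduces the case of the first half to that of the
-- second.
⊞-bent : ∀ {F : 𝔽₂^ p → 𝔽₂^ m} {G : 𝔽₂^ n → 𝔽₂^ m} → IsBent F → IsBent G → IsBent (F ⊞ G)
⊞-bent {p} {m} {n} {F} {G} bentF bentG c c≢𝟎 β =
  subst (λ c → pow m * ♯ (∂ c (F ⊞ G)) β ≡ pow (p ℕ.+ n)) (take++drop≡id p c)
    (trans (cong (pow m *_) (♯-cong (∂-⊞ F G a b) β)) uniform)
  where
  a = take p c
  b = drop p c
  uniform : pow m * ♯ (∂ a F ⊞ ∂ b G) β ≡ pow (p ℕ.+ n)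
  uniform with b ≟ 𝟎
  ... | no b≢𝟎 = ⊞-uniform (∂ a F) (∂ b G) (bentG b b≢𝟎) β
  ... | yes b≡𝟎 = begin
    pow m * ♯ (∂ a F ⊞ ∂ b G) β  ≡⟨ cong (pow m *_) (♯-⊞-comm (∂ a F) (∂ b G) β) ⟩
    pow m * ♯ (∂ b G ⊞ ∂ a F) β  ≡⟨ ⊞-uniform (∂ b G) (∂ a F) (bentF a a≢𝟎) β ⟩
    pow (n ℕ.+ p)                ≡⟨ cong pow (ℕ.+-comm n p) ⟩
    pow (p ℕ.+ n)                ∎
    where
    open ≡-Reasoning
    a≢𝟎 : a ≢ 𝟎
    a≢𝟎 a≡𝟎 = c≢𝟎 (trans (sym (take++drop≡id p c)) (trans (cong₂ _++_ a≡𝟎 b≡𝟎) (𝟎-++ p)))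

-- Inserting the distribution of `G` into the convolution leaves a constant and a multiple of the
-- count of `F` at β + α′; inserting that of `F` then multiplies the parameters.
⊞-type : ∀ {F : 𝔽₂^ p → 𝔽₂^ 2} {G : 𝔽₂^ n → 𝔽₂^ 2} {v w α α′} →
  HasType v F α → HasType w G α′ → HasType (v * w) (F ⊞ G) (α ⊕ α′)
⊞-type {p} {n} {F} {G} {v} {w} {α} {α′} typeF typeG β = begin
  + 4 * ♯ (F ⊞ G) β
    ≡⟨ cong (+ 4 *_) (♯-⊞ F G β) ⟩
  + 4 * ∑ (λ x → ♯ G (β ⊕ F x))
    ≡⟨ *-distribˡ-∑ (+ 4) (λ x → ♯ G (β ⊕ F x)) ⟩
  ∑ (λ x → + 4 * ♯ G (β ⊕ F x))
    ≡⟨ ∑-cong summand ⟩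
  ∑ (λ x → (pow n - w) + (+ 4 * w) * δ (F x) (β ⊕ α′))
    ≡⟨ ∑-distrib-+ (λ _ → pow n - w) (λ x → (+ 4 * w) * δ (F x) (β ⊕ α′)) ⟩
  ∑ {p} (λ _ → pow n - w) + ∑ (λ x → (+ 4 * w) * δ (F x) (β ⊕ α′))
    ≡⟨ cong₂ _+_ (∑-const p (pow n - w)) (sym (*-distribˡ-∑ (+ 4 * w) (λ x → δ (F x) (β ⊕ α′)))) ⟩
  pow p * (pow n - w) + (+ 4 * w) * ♯ F (β ⊕ α′)
    ≡⟨ regroup (pow p) (pow n) w (♯ F (β ⊕ α′)) ⟩
  pow p * pow n + w * (+ 4 * ♯ F (β ⊕ α′) - pow p)
    ≡⟨ cong (λ i → pow p * pow n + w * (i - pow p)) (typeF (β ⊕ α′)) ⟩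
  pow p * pow n + w * ((pow p + v * (+ 4 * δ (β ⊕ α′) α - 1ℤ)) - pow p)
    ≡⟨ cancel (pow p) (pow n) v w (δ (β ⊕ α′) α) ⟩
  pow p * pow n + (v * w) * (+ 4 * δ (β ⊕ α′) α - 1ℤ)
    ≡⟨ cong₂ (λ i d → i + (v * w) * (+ 4 * d - 1ℤ)) (sym (pow-+ p n)) (δ-shift β α′ α) ⟩
  pow (p ℕ.+ n) + (v * w) * (+ 4 * δ β (α ⊕ α′) - 1ℤ) ∎
  where
  open ≡-Reasoning
  expand : ∀ q w d → q + w * (+ 4 * d - 1ℤ) ≡ (q - w) + (+ 4 * w) * d
  expand = solve-∀
  regroup : ∀ r q w N → r * (q - w) + (+ 4 * w) * N ≡ r * q + w * (+ 4 * N - r)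
  regroup = solve-∀
  cancel : ∀ r q v w d →
    r * q + w * ((r + v * (+ 4 * d - 1ℤ)) - r) ≡ r * q + (v * w) * (+ 4 * d - 1ℤ)
  cancel = solve-∀
  shift : ∀ x → δ (β ⊕ F x) α′ ≡ δ (F x) (β ⊕ α′)
  shift x = begin
    δ (β ⊕ F x) α′   ≡⟨ cong (λ y → δ y α′) (⊕-comm β (F x)) ⟩
    δ (F x ⊕ β) α′   ≡⟨ δ-shift (F x) β α′ ⟩
    δ (F x) (α′ ⊕ β) ≡⟨ cong (δ (F x)) (⊕-comm α′ β) ⟩
    δ (F x) (β ⊕ α′) ∎
  summand : ∀ x → + 4 * ♯ G (β ⊕ F x) ≡ (pow n - w) + (+ 4 * w) * δ (F x) (β ⊕ α′)
  summand x = begin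
    + 4 * ♯ G (β ⊕ F x)                             ≡⟨ typeG (β ⊕ F x) ⟩
    pow n + w * (+ 4 * δ (β ⊕ F x) α′ - 1ℤ)         ≡⟨ expand (pow n) w (δ (β ⊕ F x) α′) ⟩
    (pow n - w) + (+ 4 * w) * δ (β ⊕ F x) α′        ≡⟨ cong (λ d → (pow n - w) + (+ 4 * w) * d) (shift x) ⟩
    (pow n - w) + (+ 4 * w) * δ (F x) (β ⊕ α′)      ∎

-- Bent functions of both types in every even dimension from 4 on.

-- The product of 𝔽₄ in the basis 1, ω; for s = true, the linear function
-- x₀ + y₀ added to the first coordinate flips exactly one Walsh sign.
Q₄ : Bool → 𝔽₂^ 4 → 𝔽₂^ 2
Q₄ s (x₀ ∷ x₁ ∷ y₀ ∷ y₁ ∷ []) =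
    (((x₀ ∧ y₀) xor (x₁ ∧ y₁)) xor (s ∧ (x₀ xor y₀)))
  ∷ (((x₀ ∧ y₁) xor (x₁ ∧ y₀)) xor (x₁ ∧ y₁))
  ∷ []

-- Likewise with the coordinates at 1 and θ² of the product of 𝔽₈, θ³ = θ + 1.
Q₆ : Bool → 𝔽₂^ 6 → 𝔽₂^ 2
Q₆ s (x₀ ∷ x₁ ∷ x₂ ∷ y₀ ∷ y₁ ∷ y₂ ∷ []) =
    (((x₀ ∧ y₀) xor ((x₁ ∧ y₂) xor (x₂ ∧ y₁))) xor (s ∧ (x₀ xor y₀)))
  ∷ (((x₀ ∧ y₂) xor (x₁ ∧ y₁)) xor ((x₂ ∧ y₀) xor (x₂ ∧ y₂)))
  ∷ []

isBent? : ∀ (F : 𝔽₂^ n → 𝔽₂^ m) → Dec (IsBent F)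
isBent? {n} {m} F = ∀? λ a → ¬? (a ≟ 𝟎) →-dec ∀? λ b → (pow m * ♯ (∂ a F) b) ℤ.≟ pow n

hasType? : ∀ w (F : 𝔽₂^ n → 𝔽₂^ 2) α → Dec (HasType w F α)
hasType? {n} w F α = ∀? λ β → (+ 4 * ♯ F β) ℤ.≟ (pow n + w * (+ 4 * δ β α - 1ℤ))

-- The derivative of the field product in a nonzero direction is affine and onto, and the extra
-- linear function shifts it only by a constant. The code verifies this by enumeration, with `s`
-- split so that the decision evaluates.
Q₄-bent : ∀ s → IsBent (Q₄ s)
Q₄-bent false = from-yes (isBent? (Q₄ false))
Q₄-bent true  = from-yes (isBent? (Q₄ true))

Q₆-bent : ∀ s → IsBent (Q₆ s)
Q₆-bent false = from-yes (isBent? (Q₆ false))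
Q₆-bent true  = from-yes (isBent? (Q₆ true))

-- The Walsh sign flipped by `s` is that of the first coordinate, `s₂` in `walsh⇒type`, so α = (s₁
-- xor s₃, s₂ xor s₃) becomes (false, s).
Q₄-type : ∀ s → HasType (sgn s * pow 2) (Q₄ s) (false ∷ s ∷ [])
Q₄-type false = from-yes (hasType? (sgn false * pow 2) (Q₄ false) (false ∷ false ∷ []))
Q₄-type true  = from-yes (hasType? (sgn true * pow 2) (Q₄ true) (false ∷ true ∷ []))

Q₆-type : ∀ s → HasType (sgn s * pow 3) (Q₆ s) (false ∷ s ∷ [])
Q₆-type false = from-yes (hasType? (sgn false * pow 3) (Q₆ false) (false ∷ false ∷ []))
Q₆-type true  = from-yes (hasType? (sgn true * pow 3) (Q₆ true) (false ∷ true ∷ []))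

-- Adding `Q₄ false`, of parameter +4, raises the dimension by 4, multiplies w by 4 = 2^2 and keeps
-- its sign; steps of 4 in the dimension need the two base cases 4 and 6.
bent-of-type : ∀ s k → Σ[ F ∈ (𝔽₂^ ((2 ℕ.+ k) ℕ.* 2) → 𝔽₂^ 2) ]
  (IsBent F × ∃ (HasType (sgn s * pow (2 ℕ.+ k)) F))
bent-of-type s zero          = Q₄ s , Q₄-bent s , _ , Q₄-type s
bent-of-type s (suc zero)    = Q₆ s , Q₆-bent s , _ , Q₆-type s
bent-of-type s (suc (suc k)) with bent-of-type s k
... | F , bent , α , type = Q₄ false ⊞ F , ⊞-bent {F = Q₄ false} {F} (Q₄-bent false) bent , _ ,
  subst (λ w → HasType w (Q₄ false ⊞ F) ((false ∷ false ∷ []) ⊕ α)) weight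
    (⊞-type {F = Q₄ false} {F} {pow 2} {sgn s * pow (2 ℕ.+ k)} {false ∷ false ∷ []} {α} (Q₄-type false) type)
  where
  scale : ∀ s a → + 4 * (s * a) ≡ s * (+ 4 * a)
  scale = solve-∀
  weight : + 4 * (sgn s * pow (2 ℕ.+ k)) ≡ sgn s * pow (4 ℕ.+ k)
  weight = trans (scale (sgn s) (pow (2 ℕ.+ k))) (cong (sgn s *_) (sym (pow-+ 2 (2 ℕ.+ k))))

-- Rational sizes

ι : ℤ → ℚ
ι z = z ℚ./ 1

¼ : ℚ
¼ = + 1 ℚ./ 4

coprime-1 : ∀ z → Coprime ℤ.∣ z ∣ 1
coprime-1 z = Coprime.sym (Coprime.1-coprimeTo ℤ.∣ z ∣)

-- Division by 1 passes through a normalisation that is stuck for a variable `z`; in constructor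
-- form, rational sums and products compute.
ι≡mkℚ : ∀ z → ι z ≡ mkℚ z 0 (coprime-1 z)
ι≡mkℚ z = ℚ.fromℚᵘ-toℚᵘ (mkℚ z 0 (coprime-1 z))

ι-+ : ∀ x y → ι (x + y) ≡ ι x ℚ.+ ι y
ι-+ x y = sym (begin
  ι x ℚ.+ ι y                  ≡⟨ cong₂ ℚ._+_ (ι≡mkℚ x) (ι≡mkℚ y) ⟩
  ι (x * + 1 + y * + 1)        ≡⟨ cong ι (cong₂ _+_ (ℤ.*-identityʳ x) (ℤ.*-identityʳ y)) ⟩
  ι (x + y)                    ∎)
  where open ≡-Reasoning

ι-* : ∀ x y → ι (x * y) ≡ ι x ℚ.* ι y
ι-* x y = sym (cong₂ ℚ._*_ (ι≡mkℚ x) (ι≡mkℚ y))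

ι-injective : ∀ {x y} → ι x ≡ ι y → x ≡ y
ι-injective {x} {y} eq = cong ℚ.numerator (trans (sym (ι≡mkℚ x)) (trans eq (ι≡mkℚ y)))

ι-quarter : ∀ z → ι (+ 4 * z) ℚ.* ¼ ≡ ι z
ι-quarter z = begin
  ι (+ 4 * z) ℚ.* ¼          ≡⟨ cong (ℚ._* ¼) (ι-* (+ 4) z) ⟩
  (ι (+ 4) ℚ.* ι z) ℚ.* ¼    ≡⟨ solve 1 (λ x → (con (ι (+ 4)) :* x) :* con ¼ := x) refl (ι z) ⟩
  ι z                        ∎
  where
  open ≡-Reasoning
  open +-*-Solver


-- For n < 2 the exponent is negative and both sides are closed rationals. Applied to n and also to
-- n/2.
2^n-2 : ∀ n → 2^ (+ n - + 2) ≡ ι (pow n) ℚ.* ¼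
2^n-2 zero          = refl
2^n-2 (suc zero)    = refl
2^n-2 (suc (suc n)) = sym (trans (cong (λ z → ι z ℚ.* ¼) (pow-+ 2 n)) (ι-quarter (pow n)))

quarter-count : ∀ N z → + 4 * + N ≡ z → fromℕ N ≡ ι z ℚ.* ¼
quarter-count N z eq = trans (sym (ι-quarter (+ N))) (cong (λ z → ι z ℚ.* ¼) eq)

quarter-pow-count : ∀ n N → fromℕ N ≡ 2^ (+ n - + 2) → + 4 * + N ≡ pow n
quarter-pow-count n N eq = ι-injective (begin
  ι (+ 4 * + N)                     ≡⟨ ι-* (+ 4) (+ N) ⟩
  ι (+ 4) ℚ.* fromℕ N               ≡⟨ cong (ι (+ 4) ℚ.*_) (trans eq (2^n-2 n)) ⟩
  ι (+ 4) ℚ.* (ι (pow n) ℚ.* ¼)     ≡⟨ solve 1 (λ x → con (ι (+ 4)) :* (x :* con ¼) := x) refl (ι (pow n)) ⟩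
  ι (pow n)                         ∎)
  where
  open ≡-Reasoning
  open +-*-Solver

Bent⇒IsBent : ∀ {F : 𝔽₂^ n → 𝔽₂^ 2} → Bent F → IsBent F
Bent⇒IsBent {n} {F} bent a a≢𝟎 b = trans
  (cong (+ 4 *_) (sym (card-∑ (λ x → ∂ a F x ≟ b))))
  (quarter-pow-count n ∣ (λ x → ∂ a F x ≟ b) ∣ (bent a a≢𝟎 b))

IsBent⇒Bent : ∀ {F : 𝔽₂^ n → 𝔽₂^ 2} → IsBent F → Bent F
IsBent⇒Bent {n} {F} bent a a≢𝟎 b = trans
  (quarter-count ∣ (λ x → ∂ a F x ≟ b) ∣ (pow n)
    (trans (cong (+ 4 *_) (card-∑ (λ x → ∂ a F x ≟ b))) (bent a a≢𝟎 b)))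
  (sym (2^n-2 n))

-- The value `d` of `δ` is a separate argument, so that `4 * d - 1` evaluates to 3 at α (`d = 1`)
-- and to -1 elsewhere (`d = 0`).
preimage-size : ∀ k s (F : 𝔽₂^ (k ℕ.* 2) → 𝔽₂^ 2) α → HasType (sgn s * pow k) F α →
  ∀ β d → δ β α ≡ d →
  fromℕ ∣ F ⁻¹⟨ β ⟩∣ ≡ (ι (pow (k ℕ.* 2)) ℚ.+ (ι (sgn s) ℚ.* ι (pow k)) ℚ.* ι (+ 4 * d - 1ℤ)) ℚ.* ¼
preimage-size k s F α type β d eq = begin
  fromℕ ∣ F ⁻¹⟨ β ⟩∣
    ≡⟨ quarter-count ∣ F ⁻¹⟨ β ⟩∣ (q + w * e)
         (trans (cong (+ 4 *_) (card-∑ (λ x → F x ≟ β)))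
           (trans (type β) (cong (λ d → q + w * (+ 4 * d - 1ℤ)) eq))) ⟩
  ι (q + w * e) ℚ.* ¼
    ≡⟨ cong (ℚ._* ¼) (ι-+ q (w * e)) ⟩
  (ι q ℚ.+ ι (w * e)) ℚ.* ¼
    ≡⟨ cong (λ x → (ι q ℚ.+ x) ℚ.* ¼) (ι-* w e) ⟩
  (ι q ℚ.+ ι w ℚ.* ι e) ℚ.* ¼
    ≡⟨ cong (λ x → (ι q ℚ.+ x ℚ.* ι e) ℚ.* ¼) (ι-* (sgn s) (pow k)) ⟩
  (ι q ℚ.+ (ι (sgn s) ℚ.* ι (pow k)) ℚ.* ι e) ℚ.* ¼ ∎
  where
  open ≡-Reasoning
  q = pow (k ℕ.* 2)
  w = sgn s * pow k
  e = + 4 * d - 1ℤ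

HasType⇒Type⁺ : ∀ k (F : 𝔽₂^ (k ℕ.* 2) → 𝔽₂^ 2) α → HasType (sgn false * pow k) F α → Type⁺ F
HasType⇒Type⁺ k F α type = divides k refl , α ,
  trans (preimage-size k false F α type α 1ℤ (δ-same α))
    (trans (at-α (ι (pow (k ℕ.* 2))) (ι (pow k)))
      (cong₂ (λ x y → x ℚ.+ ι (pow k) ℚ.- y) (sym (2^n-2 (k ℕ.* 2))) (sym (2^n-2 k)))) ,
  λ β β≢α → trans (preimage-size k false F α type β 0ℤ (δ-distinct β≢α))
    (trans (off-α (ι (pow (k ℕ.* 2))) (ι (pow k)))
      (cong₂ ℚ._-_ (sym (2^n-2 (k ℕ.* 2))) (sym (2^n-2 k))))
  where
  open +-*-Solver
  -- Three quarters of r = 2^(n/2) are split as r - r/4 to match 2^(n/2) - 2^(n/2-2).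
  at-α : ∀ q r → (q ℚ.+ (ι 1ℤ ℚ.* r) ℚ.* ι (+ 3)) ℚ.* ¼ ≡ q ℚ.* ¼ ℚ.+ r ℚ.- r ℚ.* ¼
  at-α = solve 2 (λ q r → (q :+ (con (ι 1ℤ) :* r) :* con (ι (+ 3))) :* con ¼
                          := (q :* con ¼ :+ r) :- r :* con ¼) refl
  off-α : ∀ q r → (q ℚ.+ (ι 1ℤ ℚ.* r) ℚ.* ι -1ℤ) ℚ.* ¼ ≡ q ℚ.* ¼ ℚ.- r ℚ.* ¼
  off-α = solve 2 (λ q r → (q :+ (con (ι 1ℤ) :* r) :* con (ι -1ℤ)) :* con ¼
                           := q :* con ¼ :- r :* con ¼) refl

HasType⇒Type⁻ : ∀ k (F : 𝔽₂^ (k ℕ.* 2) → 𝔽₂^ 2) α → HasType (sgn true * pow k) F α → Type⁻ F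
HasType⇒Type⁻ k F α type = divides k refl , α ,
  trans (preimage-size k true F α type α 1ℤ (δ-same α))
    (trans (at-α (ι (pow (k ℕ.* 2))) (ι (pow k)))
      (cong₂ (λ x y → x ℚ.- ι (pow k) ℚ.+ y) (sym (2^n-2 (k ℕ.* 2))) (sym (2^n-2 k)))) ,
  λ β β≢α → trans (preimage-size k true F α type β 0ℤ (δ-distinct β≢α))
    (trans (off-α (ι (pow (k ℕ.* 2))) (ι (pow k)))
      (cong₂ ℚ._+_ (sym (2^n-2 (k ℕ.* 2))) (sym (2^n-2 k))))
  where
  open +-*-Solver
  at-α : ∀ q r → (q ℚ.+ (ι -1ℤ ℚ.* r) ℚ.* ι (+ 3)) ℚ.* ¼ ≡ q ℚ.* ¼ ℚ.- r ℚ.+ r ℚ.* ¼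
  at-α = solve 2 (λ q r → (q :+ (con (ι -1ℤ) :* r) :* con (ι (+ 3))) :* con ¼
                          := (q :* con ¼ :- r) :+ r :* con ¼) refl
  off-α : ∀ q r → (q ℚ.+ (ι -1ℤ ℚ.* r) ℚ.* ι -1ℤ) ℚ.* ¼ ≡ q ℚ.* ¼ ℚ.+ r ℚ.* ¼
  off-α = solve 2 (λ q r → (q :+ (con (ι -1ℤ) :* r) :* con (ι -1ℤ)) :* con ¼
                           := q :* con ¼ :+ r :* con ¼) refl

theorem5p3 : (∀ (n : ℕ) (F : 𝔽₂^ n → 𝔽₂^ 2) → Bent F → Type⁺ F ⊎ Type⁻ F)
    × (∀ (n : ℕ) → 2 ∣ n → 4 ≤ n →
    (Σ[ F ∈ (𝔽₂^ n → 𝔽₂^ 2) ] (Bent F × Type⁺ F))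
    × (Σ[ F ∈ (𝔽₂^ n → 𝔽₂^ 2) ] (Bent F × Type⁻ F)))
theorem5p3 = (λ n F bent → toTypes F (bent⇒type F (Bent⇒IsBent {F = F} bent))) , existence
  where
  toTypes : ∀ {n} (F : 𝔽₂^ n → 𝔽₂^ 2) →
    Σ[ k ∈ ℕ ] (n ≡ k ℕ.* 2 × Σ[ s ∈ Bool ] ∃ (HasType (sgn s * pow k) F)) → Type⁺ F ⊎ Type⁻ F
  toTypes F (k , refl , false , α , type) = inj₁ (HasType⇒Type⁺ k F α type)
  toTypes F (k , refl , true  , α , type) = inj₂ (HasType⇒Type⁻ k F α type)

  positive : ∀ k → Σ[ F ∈ (𝔽₂^ ((2 ℕ.+ k) ℕ.* 2) → 𝔽₂^ 2) ] (Bent F × Type⁺ F)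
  positive k = let F , bent , α , type = bent-of-type false k in
    F , IsBent⇒Bent {F = F} bent , HasType⇒Type⁺ (2 ℕ.+ k) F α type

  negative : ∀ k → Σ[ F ∈ (𝔽₂^ ((2 ℕ.+ k) ℕ.* 2) → 𝔽₂^ 2) ] (Bent F × Type⁻ F)
  negative k = let F , bent , α , type = bent-of-type true k in
    F , IsBent⇒Bent {F = F} bent , HasType⇒Type⁻ (2 ℕ.+ k) F α type

  existence : ∀ (n : ℕ) → 2 ∣ n → 4 ≤ n →
    (Σ[ F ∈ (𝔽₂^ n → 𝔽₂^ 2) ] (Bent F × Type⁺ F))
    × (Σ[ F ∈ (𝔽₂^ n → 𝔽₂^ 2) ] (Bent F × Type⁻ F))
  -- The quotients 0 and 1 are the dimensions 0 and 2, excluded by 4 ≤ n.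
  existence _ (divides-refl zero)          ()
  existence _ (divides-refl (suc zero))    (s≤s (s≤s ()))
  existence _ (divides-refl (suc (suc k))) _ = positive k , negative k
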